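{- Let $\mathcal{K}$ be the class of $\{\to\}$-subreducts of subresiduated lattices (viewed as algebras $(A,\to,1)$ of type $(2,0)$). Then every member of $\mathcal{K}$ is a sub-Hilbert algebra.
   Context: A subresiduated lattice is an algebra $(A,\wedge,\vee,\to,0,1)$ of type $(2,2,2,0,0)$ such that $(A,\wedge,\vee,0,1)$ is a bounded distributive lattice and for all $x,y,z\in A$: $x\to x=1$; $x\to y\le z\to(x\to y)$; $x\wedge(x\to y)\le y$; $z\to(x\wedge y)=(z\to x)\wedge(z\to y)$; $(x\vee y)\to z=(x\to z)\wedge(y\to z)$; $(x\to y)\wedge(y\to z)\le x\to z$. A $\{\to\}$-subreduct of a subresiduated lattice $A$ is any isomorphic image of a (nonempty) subalgebra of the reduct $(A,\to)$. Since $1=x\to x$, such a subalgebra always contains $1$, so it is viewed as an algebra of type $(2,0)$ with operations $\to,1$. A sub-Hilbert algebra is an algebra $(A,\to,1)$ of type $(2,0)$ satisfying, for all $x,y,z\in A$: (B) $(x\to y)\to((y\to z)\to(x\to z))=1$; (I) $x\to x=1$; (T) $x\to 1=1$; (A) if $x\to y=1$ and $y\to x=1$ then $x=y$; (S) $(x\to(y\to z))\to((x\to y)\to(x\to z))=1$. -}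

module Defs where

open import Level using (Level; _⊔_) renaming (suc to lsuc)
open import Data.Product using (Σ-syntax; ∃; ∃-syntax; _,_; proj₁)
open import Function using (_on_)
open import Algebra using (Op₂; RawMonoid)
open import Algebra.Definitions using (Congruent₂)
open import Algebra.Structures using (IsMagma)
open import Algebra.Lattice.Structures using (IsDistributiveLattice)
open import Algebra.Morphism.Structures using (module MonoidMorphisms)
open import Relation.Binary using (Rel; Minimum; Maximum; _Respects_)
open import Relation.Unary using (Pred; _∈_; Satisfiable)
import Relation.Binary.Construct.NaturalOrder.Left as NaturalOrder
import Relation.Binary.Construct.On as On

-- The equality of an algebra is a setoid equality _≈_ throughout, so every
-- operation is required to be a congruence. The implication x → y is x ⇨ y.

record SubresiduatedLattice a ℓ : Set (lsuc (a ⊔ ℓ)) where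
  infix  4 _≈_
  infixr 5 _⇨_
  infixr 6 _∨_
  infixr 7 _∧_
  field
    Carrier : Set a
    _≈_     : Rel Carrier ℓ
    _∧_     : Op₂ Carrier
    _∨_     : Op₂ Carrier
    _⇨_     : Op₂ Carrier
    0#      : Carrier
    1#      : Carrier
    isDistributiveLattice : IsDistributiveLattice _≈_ _∨_ _∧_

  open IsDistributiveLattice isDistributiveLattice public

  -- x ≤ y is x ≈ x ∧ y.
  open NaturalOrder _≈_ _∧_ public using (_≤_)

  field
    0-minimum : Minimum _≤_ 0#
    1-maximum : Maximum _≤_ 1#
    ⇨-cong    : Congruent₂ _≈_ _⇨_
    ⇨-refl    : ∀ x → (x ⇨ x) ≈ 1#
    ⇨-weaken  : ∀ x y z → (x ⇨ y) ≤ (z ⇨ (x ⇨ y))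
    ⇨-eval    : ∀ x y → (x ∧ (x ⇨ y)) ≤ y
    ⇨-∧       : ∀ x y z → (z ⇨ (x ∧ y)) ≈ ((z ⇨ x) ∧ (z ⇨ y))
    ∨-⇨       : ∀ x y z → ((x ∨ y) ⇨ z) ≈ ((x ⇨ z) ∧ (y ⇨ z))
    ⇨-trans   : ∀ x y z → ((x ⇨ y) ∧ (y ⇨ z)) ≤ (x ⇨ z)

-- An arbitrary algebra (A, →, 1) of type (2,0). IsMagma says only that _≈_
-- is an equivalence relation which _⇨_ respects.

record ImplicationAlgebra c ℓ : Set (lsuc (c ⊔ ℓ)) where
  infix  4 _≈_
  infixr 5 _⇨_
  field
    Carrier : Set c
    _≈_     : Rel Carrier ℓ
    _⇨_     : Op₂ Carrier
    1#      : Carrier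
    isMagma : IsMagma _≈_ _⇨_

  open IsMagma isMagma public renaming (∙-cong to ⇨-cong)

  -- RawMonoid is the library's law-free signature of type (2,0).
  rawMonoid : RawMonoid c ℓ
  rawMonoid = record { _≈_ = _≈_ ; _∙_ = _⇨_ ; ε = 1# }

record IsSubHilbertAlgebra {c ℓ} (H : ImplicationAlgebra c ℓ) : Set (c ⊔ ℓ) where
  open ImplicationAlgebra H using (Carrier; _≈_; _⇨_; 1#)
  field
    B : ∀ x y z → ((x ⇨ y) ⇨ ((y ⇨ z) ⇨ (x ⇨ z))) ≈ 1#
    I : ∀ x → (x ⇨ x) ≈ 1#
    T : ∀ x → (x ⇨ 1#) ≈ 1#
    A : ∀ x y → (x ⇨ y) ≈ 1# → (y ⇨ x) ≈ 1# → x ≈ y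
    S : ∀ x y z → ((x ⇨ (y ⇨ z)) ⇨ ((x ⇨ y) ⇨ (x ⇨ z))) ≈ 1#

-- Isomorphism of algebras of type (2,0): a bijection preserving → and 1.

_≅_ : ∀ {c₁ ℓ₁ c₂ ℓ₂} → ImplicationAlgebra c₁ ℓ₁ → ImplicationAlgebra c₂ ℓ₂ →
      Set (c₁ ⊔ ℓ₁ ⊔ c₂ ⊔ ℓ₂)
A ≅ B = ∃[ φ ] MonoidMorphisms.IsMonoidIsomorphism
                 (ImplicationAlgebra.rawMonoid A)
                 (ImplicationAlgebra.rawMonoid B) φ

-- Nonempty subuniverses of the reduct (L, →); membership of 1 is not assumed
-- but derived below from 1 ≈ x → x.

record ⇨-Subalgebra {a ℓ} (L : SubresiduatedLattice a ℓ) p :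
                    Set (a ⊔ ℓ ⊔ lsuc p) where
  open SubresiduatedLattice L
  field
    member   : Pred Carrier p
    resp     : member Respects _≈_
    nonempty : Satisfiable member
    closed   : ∀ {x y} → x ∈ member → y ∈ member → (x ⇨ y) ∈ member

  1∈ : 1# ∈ member
  1∈ = let x , x∈ = nonempty in resp (⇨-refl x) (closed x∈ x∈)

  algebra : ImplicationAlgebra (a ⊔ p) ℓ
  algebra = record
    { Carrier = ∃ member
    ; _≈_     = _≈_ on proj₁
    ; _⇨_     = λ (x , x∈) (y , y∈) → (x ⇨ y) , closed x∈ y∈
    ; 1#      = 1# , 1∈
    ; isMagma = record
      { isEquivalence = On.isEquivalence proj₁ isEquivalence
      ; ∙-cong        = ⇨-cong
      }
    }

-- The class of {→}-subreducts of subresiduated lattices. The levels a, ℓ₁, p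
-- bound the sizes of the lattice, its equality and the subset.

𝒦 : ∀ a ℓ₁ p {c ℓ} →
    Pred (ImplicationAlgebra c ℓ) (lsuc (a ⊔ ℓ₁ ⊔ p) ⊔ c ⊔ ℓ)
𝒦 a ℓ₁ p A =
  Σ[ L ∈ SubresiduatedLattice a ℓ₁ ] Σ[ S ∈ ⇨-Subalgebra L p ]
    ⇨-Subalgebra.algebra S ≅ A

{-# OPTIONS --safe #-}

-- In a subresiduated lattice an implication u satisfies u ≤ z ⇨ u for every
-- z. Elements with this property are closed under meets, and for them the
-- left-to-right half of residuation holds: u ∧ x ≤ y implies u ≤ x ⇨ y.
-- As x ≤ y iff x ⇨ y ≈ 1, (B) and (S) follow by residuating meets of
-- implications. An algebra that embeds in a sub-Hilbert algebra is again one.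

module Submission where

open import Level using (Level)
open import Relation.Unary using (Pred; _∈_)
open import Defs
open import Algebra.Lattice.Bundles using (Lattice)
open import Algebra.Morphism.Structures using (module MonoidMorphisms)
open import Data.Product using (_,_; proj₁; proj₂; ∃-syntax)
import Algebra.Lattice.Properties.Lattice as LatticeProperties
import Relation.Binary.Lattice as OrderLattice
import Relation.Binary.Lattice.Properties.MeetSemilattice as MeetProperties
import Relation.Binary.Reasoning.PartialOrder as ≤-Reasoning

module SubresiduatedLatticeProperties {a ℓ} (L : SubresiduatedLattice a ℓ) where
  open SubresiduatedLattice L

  lattice : Lattice a ℓ
  lattice = record { isLattice = isLattice }

  private
    meetSemilattice : OrderLattice.MeetSemilattice a ℓ ℓ
    meetSemilattice =
      LatticeProperties.∧-orderTheoreticMeetSemilattice lattice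

  open OrderLattice.MeetSemilattice meetSemilattice
    using (poset; antisym; x∧y≤x; x∧y≤y; ∧-greatest)
    renaming (refl to ≤-refl)
  open MeetProperties meetSemilattice using (∧-monotonic)
  open ≤-Reasoning poset

  ⇨-monoʳ : ∀ {x y} z → x ≤ y → (z ⇨ x) ≤ (z ⇨ y)
  ⇨-monoʳ {x} {y} z x≤y = begin
    -- The order is equational: `x ≤ y` unfolds to `x ≈ x ∧ y`, so the hypothesis itself serves as
    -- the rewrite. `1-maximum` is used as an equation in the same way below.
    z ⇨ x              ≈⟨ ⇨-cong refl x≤y ⟩
    z ⇨ (x ∧ y)        ≈⟨ ⇨-∧ x y z ⟩
    (z ⇨ x) ∧ (z ⇨ y)  ≤⟨ x∧y≤y _ _ ⟩
    z ⇨ y              ∎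

  ≤⇒⇨≈1 : ∀ {x y} → x ≤ y → (x ⇨ y) ≈ 1#
  ≤⇒⇨≈1 {x} {y} x≤y = antisym (1-maximum _) (begin
    1#     ≈⟨ ⇨-refl x ⟨
    x ⇨ x  ≤⟨ ⇨-monoʳ x x≤y ⟩
    x ⇨ y  ∎)

  ⇨≈1⇒≤ : ∀ {x y} → (x ⇨ y) ≈ 1# → x ≤ y
  ⇨≈1⇒≤ {x} {y} x⇨y≈1 = begin
    x            ≈⟨ 1-maximum x ⟩
    x ∧ 1#       ≈⟨ ∧-cong refl x⇨y≈1 ⟨
    x ∧ (x ⇨ y)  ≤⟨ ⇨-eval x y ⟩
    y            ∎

  -- These are exactly the fixed points of `1# ⇨_`: taking `z` to be `1#` gives one direction by
  -- `⇨-eval`, and `⇨-weaken` gives the other.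
  Persistent : Pred Carrier _
  Persistent u = ∀ z → u ≤ (z ⇨ u)

  ∧-persistent : ∀ {u v} → Persistent u → Persistent v → Persistent (u ∧ v)
  ∧-persistent {u} {v} pu pv z = begin
    u ∧ v              ≤⟨ ∧-monotonic (pu z) (pv z) ⟩
    (z ⇨ u) ∧ (z ⇨ v)  ≈⟨ ⇨-∧ u v z ⟨
    z ⇨ (u ∧ v)        ∎

  -- Persistence puts `u` below `x ⇨ u`; meeting with `x ⇨ x`, which is the top, turns this into
  -- `x ⇨ (u ∧ x)`.
  ⇨-residual : ∀ {u x y} → Persistent u → (u ∧ x) ≤ y → u ≤ (x ⇨ y)
  ⇨-residual {u} {x} {y} pu u∧x≤y = begin
    u                  ≤⟨ pu x ⟩
    x ⇨ u              ≈⟨ 1-maximum (x ⇨ u) ⟩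
    (x ⇨ u) ∧ 1#       ≈⟨ ∧-cong refl (⇨-refl x) ⟨
    (x ⇨ u) ∧ (x ⇨ x)  ≈⟨ ⇨-∧ u x x ⟨
    x ⇨ (u ∧ x)        ≤⟨ ⇨-monoʳ x u∧x≤y ⟩
    x ⇨ y              ∎

  -- Transitivity is the form of this inequality with `y ⇨ z` still on the left; it moves across
  -- because the implication `x ⇨ y` is persistent.
  ⇨-B : ∀ x y z → (x ⇨ y) ≤ ((y ⇨ z) ⇨ (x ⇨ z))
  ⇨-B x y z = ⇨-residual (⇨-weaken x y) (⇨-trans x y z)

  -- Residuating twice leaves `(u ∧ v) ∧ x ≤ z`, which is modus ponens used three times. The inner
  -- residuation has the meet `u ∧ v` on the left, hence the closure of persistence under meets.
  ⇨-S : ∀ x y z → (x ⇨ (y ⇨ z)) ≤ ((x ⇨ y) ⇨ (x ⇨ z))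
  ⇨-S x y z = ⇨-residual (⇨-weaken x (y ⇨ z))
    (⇨-residual (∧-persistent (⇨-weaken x (y ⇨ z)) (⇨-weaken x y))
      (begin
        (u ∧ v) ∧ x  ≤⟨ ∧-greatest (apply (x∧y≤y u v))
                                   (apply (x∧y≤x u v)) ⟩
        y ∧ (y ⇨ z)  ≤⟨ ⇨-eval y z ⟩
        z            ∎))
    where
    u = x ⇨ (y ⇨ z)
    v = x ⇨ y

    -- The converse half of residuation, valid for arbitrary `w`.
    apply : ∀ {w t} → w ≤ (x ⇨ t) → (w ∧ x) ≤ t
    apply {w} {t} w≤x⇨t = begin
      w ∧ x        ≈⟨ ∧-comm w x ⟩
      x ∧ w        ≤⟨ ∧-monotonic ≤-refl w≤x⇨t ⟩
      x ∧ (x ⇨ t)  ≤⟨ ⇨-eval x t ⟩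
      t            ∎

  subalgebra-isSubHilbert : ∀ {p} (S : ⇨-Subalgebra L p) →
                            IsSubHilbertAlgebra (⇨-Subalgebra.algebra S)
  subalgebra-isSubHilbert S = record
    { B = λ (x , _) (y , _) (z , _) → ≤⇒⇨≈1 (⇨-B x y z)
    ; I = λ (x , _) → ⇨-refl x
    ; T = λ (x , _) → ≤⇒⇨≈1 (1-maximum x)
    ; A = λ _ _ x⇨y≈1 y⇨x≈1 → antisym (⇨≈1⇒≤ x⇨y≈1) (⇨≈1⇒≤ y⇨x≈1)
    ; S = λ (x , _) (y , _) (z , _) → ≤⇒⇨≈1 (⇨-S x y z)
    }

module _ {c₁ ℓ₁ c₂ ℓ₂}
         (H : ImplicationAlgebra c₁ ℓ₁) (K : ImplicationAlgebra c₂ ℓ₂) where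
  private
    module H = ImplicationAlgebra H
    module K = ImplicationAlgebra K
    module H→K = MonoidMorphisms H.rawMonoid K.rawMonoid
    module K→H = MonoidMorphisms K.rawMonoid H.rawMonoid

  -- Membership in `𝒦` gives an isomorphism out of the subalgebra, whereas laws are pulled back
  -- along an embedding into it. Equations between values of `ψ` are checked after applying the
  -- injective `φ`, where `φ` and `ψ` cancel.
  isomorphism⇒inverse-monomorphism :
    ∀ {φ} → H→K.IsMonoidIsomorphism φ → ∃[ ψ ] K→H.IsMonoidMonomorphism ψ
  isomorphism⇒inverse-monomorphism {φ} iso = ψ , record
    { isMonoidHomomorphism = record
      { isMagmaHomomorphism = record
        { isRelHomomorphism = record
          { cong = λ {x} {y} x≈y → injective
              (K.trans (φψ x) (K.trans x≈y (K.sym (φψ y))))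
          }
        ; homo = λ x y → injective (K.trans (φψ (x K.⇨ y)) (K.sym
            (K.trans (homo (ψ x) (ψ y)) (K.⇨-cong (φψ x) (φψ y)))))
        }
      ; ε-homo = injective (K.trans (φψ K.1#) (K.sym ε-homo))
      }
    ; injective = λ {x} {y} ψx≈ψy →
        K.trans (K.sym (φψ x)) (K.trans (⟦⟧-cong ψx≈ψy) (φψ y))
    }
    where
    open H→K.IsMonoidIsomorphism iso

    ψ : K.Carrier → H.Carrier
    ψ y = proj₁ (surjective y)

    φψ : ∀ y → φ (ψ y) K.≈ y
    -- Surjectivity sends everything equal to the chosen preimage to `y`; reflexivity selects the
    -- preimage itself.
    φψ y = proj₂ (surjective y) H.refl

  -- Injectivity reflects equations with `1#`. For the quasi-identity (A) the premises are first
  -- pushed forward along `φ`.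
  monomorphism-reflects-isSubHilbert :
    ∀ {φ} → H→K.IsMonoidMonomorphism φ →
    IsSubHilbertAlgebra K → IsSubHilbertAlgebra H
  monomorphism-reflects-isSubHilbert {φ} mono subHilbert = record
    { B = λ x y z → reflects-1
        -- The proof mirrors the syntax of the law and pushes `φ` inward to the variables.
        ((φ[ x ] ⟨⇨⟩ φ[ y ]) ⟨⇨⟩ (φ[ y ] ⟨⇨⟩ φ[ z ]) ⟨⇨⟩ φ[ x ] ⟨⇨⟩ φ[ z ])
        (B (φ x) (φ y) (φ z))
    ; I = λ x → reflects-1 (φ[ x ] ⟨⇨⟩ φ[ x ]) (I (φ x))
    ; T = λ x → reflects-1 (φ[ x ] ⟨⇨⟩ ε-homo) (T (φ x))
    ; A = λ x y x⇨y≈1 y⇨x≈1 → injective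
        (A (φ x) (φ y) (preserves-1 x⇨y≈1) (preserves-1 y⇨x≈1))
    ; S = λ x y z → reflects-1
        ((φ[ x ] ⟨⇨⟩ φ[ y ] ⟨⇨⟩ φ[ z ]) ⟨⇨⟩
         (φ[ x ] ⟨⇨⟩ φ[ y ]) ⟨⇨⟩ φ[ x ] ⟨⇨⟩ φ[ z ])
        (S (φ x) (φ y) (φ z))
    }
    where
    open H→K.IsMonoidMonomorphism mono
    open IsSubHilbertAlgebra subHilbert

    φ[_] : ∀ x → φ x K.≈ φ x
    φ[ x ] = K.refl

    infixr 5 _⟨⇨⟩_
    _⟨⇨⟩_ : ∀ {x y u v} → φ x K.≈ u → φ y K.≈ v → φ (x H.⇨ y) K.≈ (u K.⇨ v)
    φx≈u ⟨⇨⟩ φy≈v = K.trans (homo _ _) (K.⇨-cong φx≈u φy≈v)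

    reflects-1 : ∀ {x u} → φ x K.≈ u → u K.≈ K.1# → x H.≈ H.1#
    reflects-1 φx≈u u≈1 =
      injective (K.trans φx≈u (K.trans u≈1 (K.sym ε-homo)))

    preserves-1 : ∀ {x y} → (x H.⇨ y) H.≈ H.1# → (φ x K.⇨ φ y) K.≈ K.1#
    preserves-1 x⇨y≈1 =
      K.trans (K.sym (homo _ _)) (K.trans (⟦⟧-cong x⇨y≈1) ε-homo)

proposition3p9 : ∀ {a ℓ₁ p c ℓ : Level} (A : ImplicationAlgebra c ℓ) →
    A ∈ 𝒦 a ℓ₁ p → IsSubHilbertAlgebra A
proposition3p9 A (L , S , _ , iso) =
  let _ , mono = isomorphism⇒inverse-monomorphism (algebra S) A iso
  in monomorphism-reflects-isSubHilbert A (algebra S) mono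
       (subalgebra-isSubHilbert L S)
  where
  open ⇨-Subalgebra using (algebra)
  open SubresiduatedLatticeProperties using (subalgebra-isSubHilbert)
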